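{- Let the sequence $\gamma(0),\gamma(1),\dots$ be defined by $\gamma(0)=0$ and recursively $$\gamma(2^l-k)=\frac{2^l+2(-1)^l}{3}-k+2\gamma(k)\qquad (l\ge 0,\ 0\le k\le 2^{l-1}).$$ For a positive integer $n$ let $b(n)$ be the number of maximal blocks of consecutive ones in the binary representation of $n$, and $b(0)=0$. Then: (i) $\gamma(2^l+k)=\frac{2^l+2(-1)^l}{3}-k+4\gamma(k)$ for all integers $l\ge0$ and $0\le k\le 2^{l-1}$; (ii) $\gamma(2^l-k)=\gamma(k)+2\gamma(2^{l-1}-k)$ for all integers $l\ge 0$ and integers $k$ with $2^{l-2}\le k\le 2^{l-1}$; (iii) $\gamma(2^l+k)=1+\gamma(2^l+k-1)+2\gamma(2^l-k)-2\gamma(2^l+1-k)$ for all integers $l\ge0$ and $1\le k\le 2^l$; (iv) for all $n\in\mathbf{N}$, $\gamma(2n)=n-\gamma(n)$ and $\gamma(2n+1)=\gamma(2n)+(2^{1+2b(n)}+1)/3=n-\gamma(n)+(2^{1+2b(n)}+1)/3$; and for all $n\ge1$, $\gamma(2n-1)=\gamma(2n)+(4^{b(2n-1)}-1)/3=n-\gamma(n)+(4^{b(2n-1)}-1)/3$.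
   Context: For example $667=(1010011011)_2$ has $b(667)=4$. Equivalently $b$ satisfies $b(0)=0$, $b(2n)=b(n)$, $b(2n+1)=b(n)+1-(n\bmod 2)$. -}

module Defs where

open import Data.Digit using (toDigits; 0b)
open import Data.Fin using (_≟_)
open import Data.Integer as ℤ using (+_; -1ℤ)
open import Data.List using (length; wordsBy)
open import Data.Nat as ℕ using (ℕ)
open import Data.Product using (proj₁)
open import Data.Rational using (ℚ; 0ℚ; _/_; _+_; _-_; _*_)
open import Relation.Binary.PropositionalEquality using (_≡_)

fromℕ : ℕ → ℚ
fromℕ n = (+ n) / 1

-- Splitting the binary digits at the zeros and discarding empty words leaves
-- exactly the maximal blocks of consecutive ones.  The digits come least
-- significant first, which does not affect the count.
b : ℕ → ℕ
b n = length (wordsBy (_≟ 0b) (proj₁ (toDigits 2 n)))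

c : ℕ → ℚ
c l = ((+ 2) ℤ.^ l ℤ.+ (+ 2) ℤ.* (-1ℤ ℤ.^ l)) / 3

-- The hypothesis k ≤ 2^(l-1) is written 2k ≤ 2^l so that it also reads
-- correctly at l = 0, where it leaves only k = 0.
--
-- Such a γ exists and is unique: each n ≥ 1 is 2^l - k for exactly one l and k
-- with 2k < 2^l, and then k < n.  The remaining instances, 2k = 2^l, follow
-- from the instance for l - 1 and k = 0.
record IsGamma (γ : ℕ → ℚ) : Set where
  field
    γ-zero : γ 0 ≡ 0ℚ
    γ-rec  : ∀ l k → 2 ℕ.* k ℕ.≤ 2 ℕ.^ l →
             γ (2 ℕ.^ l ℕ.∸ k) ≡ c l - fromℕ k + fromℕ 2 * γ k

-- The recursion relates n and k whenever n + k = 2^l and k ≤ n, and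
-- c l + c (l+1) = 2^l turns it into γ(2n) = n - γ(n).  Writing the recursion for
-- two neighbours of 2n shows that the gap between γ at an odd number and at an
-- even neighbour is an affine function of such a gap at the reflected place
-- 2^(l+1) - 2n; iterating gives (2·4^e + 1)/3 above 2n and (4^e - 1)/3 below it.
-- The exponent e counts blocks of ones because reflection complements the binary
-- digits, exchanging blocks of ones and blocks of zeros.
module Submission where

open import Defs
open import Data.Digit using (Bit; Expansion; fromDigits; toDigits; 0b; 1b)
open import Data.Fin using (zero; suc; _≟_)
open import Data.Integer as ℤ using (+_; -1ℤ; 1ℤ)
import Data.Integer.Properties as ℤ
open import Data.List using (List; []; _∷_; length; wordsBy)
open import Data.Nat as ℕ using (ℕ; zero; suc; z≤n; s≤s)
open import Data.Nat.Induction using (<-rec)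
import Data.Nat.Properties as ℕ
open import Data.Nat.Tactic.RingSolver using (solve-∀)
open import Data.Product using (_×_; _,_; proj₁; proj₂; ∃; ∃₂)
open import Data.Rational using (ℚ; 0ℚ; 1ℚ; _/_; _+_; _-_; _*_; fromℚᵘ)
open import Data.Rational.Properties
  using (toℚᵘ-injective; toℚᵘ-fromℚᵘ; toℚᵘ-homo-+; toℚᵘ-homo-*)
open import Data.Rational.Solver using (module +-*-Solver)
import Data.Rational.Unnormalised as ℚᵘ
import Data.Rational.Unnormalised.Properties as ℚᵘ
open import Data.Sum using (_⊎_; inj₁; inj₂)
open import Relation.Binary.PropositionalEquality
  using (_≡_; refl; sym; trans; cong; cong₂; subst; module ≡-Reasoning)
open import Relation.Nullary using (contradiction)

open +-*-Solver using (solve; con; _:=_; _:+_; _:-_; _:*_)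

-- Blocks of ones in lists of binary digits.

-- The accumulating loop of wordsBy is local to the library and cannot be named:
-- abstracting the accumulator in the goal lets unification find it.
mutual
  wordsBy-loop : List Bit → List Bit → List (List Bit)
  wordsBy-loop = _

  wordsBy-one : ∀ ds → wordsBy (_≟ 0b) (1b ∷ ds) ≡ wordsBy-loop (1b ∷ []) ds
  wordsBy-one ds with 1b ∷ []
  ... | acc = refl

-- A nonempty unfinished word contributes exactly one word to the count, whatever digits it holds.
length-loop : ∀ x y xs ys ds →
  length (wordsBy-loop (x ∷ xs) ds) ≡ length (wordsBy-loop (y ∷ ys) ds)
length-loop x y xs ys [] = refl
length-loop x y xs ys (zero ∷ ds) = refl
length-loop x y xs ys (suc zero ∷ ds) = length-loop 1b 1b (x ∷ xs) (y ∷ ys) ds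

blocks : Expansion 2 → ℕ
blocks ds = length (wordsBy (_≟ 0b) ds)

blocks-11 : ∀ ds → blocks (1b ∷ 1b ∷ ds) ≡ blocks (1b ∷ ds)
blocks-11 = length-loop 1b 1b (1b ∷ []) []

-- Expansions of one number differ only by zeros at the most significant end, so `b` may be read off
-- any of them. The second component, with a block already open, is what the induction needs when
-- both lists start with a one.
fromDigits-blocks : ∀ ds es → fromDigits ds ≡ fromDigits es →
  blocks ds ≡ blocks es × blocks (1b ∷ ds) ≡ blocks (1b ∷ es)
fromDigits-blocks [] [] eq = refl , refl
fromDigits-blocks [] (zero ∷ es) eq
  with p , q ← fromDigits-blocks [] es (ℕ.*-cancelʳ-≡ 0 (fromDigits es) 2 eq) = p , cong suc p
fromDigits-blocks (zero ∷ ds) [] eq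
  with p , q ← fromDigits-blocks ds [] (ℕ.*-cancelʳ-≡ (fromDigits ds) 0 2 eq) = p , cong suc p
fromDigits-blocks (zero ∷ ds) (zero ∷ es) eq
  with p , q ← fromDigits-blocks ds es (ℕ.*-cancelʳ-≡ (fromDigits ds) (fromDigits es) 2 eq) = p , cong suc p
fromDigits-blocks (suc zero ∷ ds) (suc zero ∷ es) eq
  with p , q ← fromDigits-blocks ds es
                 (ℕ.*-cancelʳ-≡ (fromDigits ds) (fromDigits es) 2 (ℕ.suc-injective eq))
  = q , trans (blocks-11 ds) (trans q (sym (blocks-11 es)))
fromDigits-blocks (zero ∷ ds) (suc zero ∷ es) eq
  rewrite ℕ.*-comm (fromDigits ds) 2 | ℕ.*-comm (fromDigits es) 2
  = contradiction eq (ℕ.even≢odd (fromDigits ds) (fromDigits es))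
fromDigits-blocks (suc zero ∷ ds) (zero ∷ es) eq
  rewrite ℕ.*-comm (fromDigits ds) 2 | ℕ.*-comm (fromDigits es) 2
  = contradiction (sym eq) (ℕ.even≢odd (fromDigits es) (fromDigits ds))

b-blocks : ∀ {n} ds → fromDigits ds ≡ n → b n ≡ blocks ds
b-blocks {n} ds eq =
  proj₁ (fromDigits-blocks (proj₁ (toDigits 2 n)) ds (trans (proj₂ (toDigits 2 n)) (sym eq)))

digits-elim : (P : ℕ → Set) → (∀ ds → P (fromDigits {2} ds)) → ∀ n → P n
digits-elim P f n = subst P (proj₂ (toDigits 2 n)) (f (proj₁ (toDigits 2 n)))

b-2n : ∀ n → b (2 ℕ.* n) ≡ b n
b-2n = digits-elim _ λ ds →
  trans (b-blocks (0b ∷ ds) (ℕ.*-comm (fromDigits ds) 2)) (sym (b-blocks ds refl))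

b-4n+1 : ∀ n → b (suc (2 ℕ.* (2 ℕ.* n))) ≡ suc (b n)
b-4n+1 = digits-elim _ λ ds →
  trans (b-blocks (1b ∷ 0b ∷ ds) (lemma (fromDigits ds))) (cong suc (sym (b-blocks ds refl)))
  where
  lemma : ∀ n → 1 ℕ.+ n ℕ.* 2 ℕ.* 2 ≡ 1 ℕ.+ 2 ℕ.* (2 ℕ.* n)
  lemma = solve-∀

b-4n+3 : ∀ n → b (suc (2 ℕ.* suc (2 ℕ.* n))) ≡ b (suc (2 ℕ.* n))
b-4n+3 = digits-elim _ λ ds →
  trans (b-blocks (1b ∷ 1b ∷ ds) (lemma (fromDigits ds)))
    (trans (blocks-11 ds) (sym (b-blocks (1b ∷ ds) (cong suc (ℕ.*-comm (fromDigits ds) 2)))))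
  where
  lemma : ∀ n → 1 ℕ.+ ((1 ℕ.+ n ℕ.* 2) ℕ.* 2) ≡ 1 ℕ.+ (2 ℕ.* (1 ℕ.+ 2 ℕ.* n))
  lemma = solve-∀

-- Binary complements and the number of blocks.

parity : ∀ n → ∃ λ h → n ≡ 2 ℕ.* h ⊎ n ≡ suc (2 ℕ.* h)
parity zero = 0 , inj₁ refl
parity (suc n) with parity n
... | h , inj₁ refl = h , inj₂ refl
... | h , inj₂ refl = suc h , inj₁ (sym (ℕ.*-suc 2 h))

2m≤2n+1⇒m≤n : ∀ m n → 2 ℕ.* m ℕ.≤ suc (2 ℕ.* n) → m ℕ.≤ n
2m≤2n+1⇒m≤n m n le = ℕ.s≤s⁻¹ (ℕ.*-cancelˡ-< 2 m (suc n)
  (ℕ.≤-trans (s≤s le) (ℕ.≤-reflexive (sym (ℕ.*-suc 2 n)))))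

-- Written with l + 1 digits, 2n and 2m + 1 are complementary, so the blocks of ones of 2m + 1 are
-- the blocks of zeros of 2n. Blocks alternate and the lowest one of 2n consists of zeros; hence
-- zeros have one block more when the top digit of 2n is zero (n <= m), and equally many otherwise.
b-complement : ∀ l n m → suc (n ℕ.+ m) ≡ 2 ℕ.^ l →
  (n ℕ.≤ m → b (suc (2 ℕ.* m)) ≡ suc (b n)) × (m ℕ.< n → b (suc (2 ℕ.* m)) ≡ b n)
b-complement zero zero zero eq = (λ _ → refl) , λ ()
b-complement (suc l) n m eq with parity n | parity m
... | h , inj₁ refl | k , inj₁ refl =
  contradiction (sym (trans (cong suc (ℕ.*-distribˡ-+ 2 h k)) eq)) (ℕ.even≢odd (2 ℕ.^ l) (h ℕ.+ k))
... | h , inj₂ refl | k , inj₂ refl =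
  contradiction (trans (sym eq) (lemma h k)) (ℕ.even≢odd (2 ℕ.^ l) (suc (h ℕ.+ k)))
  where
  lemma : ∀ h k → 1 ℕ.+ ((1 ℕ.+ 2 ℕ.* h) ℕ.+ (1 ℕ.+ 2 ℕ.* k)) ≡ 1 ℕ.+ (2 ℕ.* (1 ℕ.+ h ℕ.+ k))
  lemma = solve-∀
... | h , inj₁ refl | k , inj₂ refl =
  (λ n≤m → trans (b-4n+3 k) (trans (proj₁ ih (2m≤2n+1⇒m≤n h k n≤m)) (cong suc (sym (b-2n h))))) ,
  (λ m<n → trans (b-4n+3 k)
    (trans (proj₂ ih (ℕ.*-cancelˡ-< 2 k h (ℕ.<-trans (ℕ.n<1+n _) m<n))) (sym (b-2n h))))
  where
  lemma : ∀ h k → 2 ℕ.* (1 ℕ.+ h ℕ.+ k) ≡ 1 ℕ.+ (2 ℕ.* h ℕ.+ (1 ℕ.+ 2 ℕ.* k))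
  lemma = solve-∀
  ih = b-complement l h k (ℕ.*-cancelˡ-≡ _ _ 2 (trans (lemma h k) eq))
... | h , inj₂ refl | k , inj₁ refl =
  (λ n≤m → trans (b-4n+1 k) (cong suc (sym (proj₂ ih (ℕ.*-cancelˡ-< 2 h k n≤m))))) ,
  (λ m<n → trans (b-4n+1 k) (sym (proj₁ ih (ℕ.*-cancelˡ-≤ 2 (ℕ.s≤s⁻¹ m<n)))))
  where
  lemma : ∀ h k → 2 ℕ.* (1 ℕ.+ k ℕ.+ h) ≡ 1 ℕ.+ ((1 ℕ.+ 2 ℕ.* h) ℕ.+ 2 ℕ.* k)
  lemma = solve-∀
  -- The halves trade places: the pair (k, h) relates `b k` to `b` of 2h + 1, which is n itself.
  ih = b-complement l k h (ℕ.*-cancelˡ-≡ _ _ 2 (trans (lemma h k) eq))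

-- Integers inside the rationals and the constants `c l`.

fromℚᵘ-homo-+ : ∀ p q → fromℚᵘ (p ℚᵘ.+ q) ≡ fromℚᵘ p + fromℚᵘ q
fromℚᵘ-homo-+ p q = toℚᵘ-injective (ℚᵘ.≃-trans (toℚᵘ-fromℚᵘ (p ℚᵘ.+ q))
  (ℚᵘ.≃-sym (ℚᵘ.≃-trans (toℚᵘ-homo-+ (fromℚᵘ p) (fromℚᵘ q))
    (ℚᵘ.+-cong (toℚᵘ-fromℚᵘ p) (toℚᵘ-fromℚᵘ q)))))

fromℚᵘ-homo-* : ∀ p q → fromℚᵘ (p ℚᵘ.* q) ≡ fromℚᵘ p * fromℚᵘ q
fromℚᵘ-homo-* p q = toℚᵘ-injective (ℚᵘ.≃-trans (toℚᵘ-fromℚᵘ (p ℚᵘ.* q))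
  (ℚᵘ.≃-sym (ℚᵘ.≃-trans (toℚᵘ-homo-* (fromℚᵘ p) (fromℚᵘ q))
    (ℚᵘ.*-cong (toℚᵘ-fromℚᵘ p) (toℚᵘ-fromℚᵘ q)))))

fromℤ-homo-+ : ∀ i j → (i ℤ.+ j) / 1 ≡ i / 1 + j / 1
fromℤ-homo-+ i j = trans
  (cong (_/ 1) (sym (cong₂ ℤ._+_ (ℤ.*-identityʳ i) (ℤ.*-identityʳ j))))
  (fromℚᵘ-homo-+ (ℚᵘ.mkℚᵘ i 0) (ℚᵘ.mkℚᵘ j 0))

fromℤ-homo-* : ∀ i j → (i ℤ.* j) / 1 ≡ i / 1 * (j / 1)
fromℤ-homo-* i j = fromℚᵘ-homo-* (ℚᵘ.mkℚᵘ i 0) (ℚᵘ.mkℚᵘ j 0)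

/3-split : ∀ i → i / 3 ≡ i / 1 * (1ℤ / 3)
/3-split i = trans (cong (_/ 3) (sym (ℤ.*-identityʳ i)))
  (fromℚᵘ-homo-* (ℚᵘ.mkℚᵘ i 0) (ℚᵘ.mkℚᵘ 1ℤ 2))

fromℕ-+ : ∀ m n → fromℕ (m ℕ.+ n) ≡ fromℕ m + fromℕ n
fromℕ-+ m n = fromℤ-homo-+ (+ m) (+ n)

fromℕ-suc : ∀ n → fromℕ (suc n) ≡ 1ℚ + fromℕ n
fromℕ-suc = fromℕ-+ 1

fromℕ-2* : ∀ n → fromℕ (2 ℕ.* n) ≡ fromℕ 2 * fromℕ n
fromℕ-2* n = trans (cong (_/ 1) (ℤ.pos-* 2 n)) (fromℤ-homo-* (+ 2) (+ n))

pos-2^ : ∀ l → + (2 ℕ.^ l) ≡ (+ 2) ℤ.^ l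
pos-2^ zero = refl
pos-2^ (suc l) = trans (ℤ.pos-* 2 (2 ℕ.^ l)) (cong ((+ 2) ℤ.*_) (pos-2^ l))

-- The alternating terms cancel, and 2^l + 2^(l+1) = 3 * 2^l.
c-+-suc : ∀ l → c l + c (suc l) ≡ fromℕ (2 ℕ.^ l)
c-+-suc l = begin
  c l + c (suc l)
    ≡⟨ cong₂ _+_ (expand x y) (expand ((+ 2) ℤ.* x) (-1ℤ ℤ.* y)) ⟩
  (x / 1 + fromℕ 2 * (y / 1)) * (1ℤ / 3) +
    (((+ 2) ℤ.* x) / 1 + fromℕ 2 * ((-1ℤ ℤ.* y) / 1)) * (1ℤ / 3)
    ≡⟨ cong₂ (λ p q → (x / 1 + fromℕ 2 * (y / 1)) * (1ℤ / 3) + (p + fromℕ 2 * q) * (1ℤ / 3))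
         (fromℤ-homo-* (+ 2) x) (fromℤ-homo-* -1ℤ y) ⟩
  (x / 1 + fromℕ 2 * (y / 1)) * (1ℤ / 3) +
    (fromℕ 2 * (x / 1) + fromℕ 2 * ((-1ℤ / 1) * (y / 1))) * (1ℤ / 3)
    ≡⟨ solve 2 (λ x y → (x :+ con (fromℕ 2) :* y) :* con (1ℤ / 3) :+
         (con (fromℕ 2) :* x :+ con (fromℕ 2) :* (con (-1ℤ / 1) :* y)) :* con (1ℤ / 3) := x)
         refl (x / 1) (y / 1) ⟩
  x / 1
    ≡⟨ cong (_/ 1) (sym (pos-2^ l)) ⟩
  fromℕ (2 ℕ.^ l) ∎
  where
  open ≡-Reasoning
  x = (+ 2) ℤ.^ l
  y = -1ℤ ℤ.^ l
  expand : ∀ i j → (i ℤ.+ (+ 2) ℤ.* j) / 3 ≡ (i / 1 + fromℕ 2 * (j / 1)) * (1ℤ / 3)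
  expand i j = trans (/3-split (i ℤ.+ (+ 2) ℤ.* j)) (cong (_* (1ℤ / 3))
    (trans (fromℤ-homo-+ i ((+ 2) ℤ.* j)) (cong (λ p → i / 1 + p) (fromℤ-homo-* (+ 2) j))))

-- Removes powers of two in favour of `c l` and `c (suc l)`, so that the later identities become
-- linear in free variables.
fromℕ-complement : ∀ l n k → n ℕ.+ k ≡ 2 ℕ.^ l → fromℕ n ≡ c l + c (suc l) - fromℕ k
fromℕ-complement l n k eq = begin
  fromℕ n                    ≡⟨ solve 2 (λ n k → n := n :+ k :- k) refl (fromℕ n) (fromℕ k) ⟩
  fromℕ n + fromℕ k - fromℕ k ≡⟨ cong (_- fromℕ k) (fromℕ-+ n k) ⟨
  fromℕ (n ℕ.+ k) - fromℕ k    ≡⟨ cong (λ m → fromℕ m - fromℕ k) eq ⟩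
  fromℕ (2 ℕ.^ l) - fromℕ k    ≡⟨ cong (_- fromℕ k) (c-+-suc l) ⟨
  c l + c (suc l) - fromℕ k   ∎
  where open ≡-Reasoning

-- The gaps at odd numbers.

-- Both gaps are excesses of γ at an odd number over an even neighbour: this one over the lower
-- neighbour, with e the blocks of the even number, and `odd-gap` over the upper neighbour, with e
-- the blocks of the odd number.
even-gap : ℕ → ℚ
even-gap e = ((+ 2) ℤ.^ (1 ℕ.+ 2 ℕ.* e) ℤ.+ 1ℤ) / 3

odd-gap : ℕ → ℚ
odd-gap e = ((+ 4) ℤ.^ e ℤ.- 1ℤ) / 3

odd-gap-expand : ∀ e → odd-gap e ≡ ((((+ 4) ℤ.^ e) / 1) - 1ℚ) * (1ℤ / 3)
odd-gap-expand e = trans (/3-split ((+ 4) ℤ.^ e ℤ.- 1ℤ))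
  (cong (_* (1ℤ / 3)) (fromℤ-homo-+ ((+ 4) ℤ.^ e) -1ℤ))

even-gap-expand : ∀ e → even-gap e ≡ (fromℕ 2 * (((+ 4) ℤ.^ e) / 1) + 1ℚ) * (1ℤ / 3)
even-gap-expand e = begin
  even-gap e
    ≡⟨ cong (λ i → ((+ 2) ℤ.* i ℤ.+ 1ℤ) / 3) (ℤ.^-*-assoc (+ 2) 2 e) ⟨
  ((+ 2) ℤ.* (+ 4) ℤ.^ e ℤ.+ 1ℤ) / 3
    ≡⟨ /3-split ((+ 2) ℤ.* (+ 4) ℤ.^ e ℤ.+ 1ℤ) ⟩
  ((+ 2) ℤ.* (+ 4) ℤ.^ e ℤ.+ 1ℤ) / 1 * (1ℤ / 3)
    ≡⟨ cong (_* (1ℤ / 3)) (trans (fromℤ-homo-+ ((+ 2) ℤ.* (+ 4) ℤ.^ e) 1ℤ)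
         (cong (_+ 1ℚ) (fromℤ-homo-* (+ 2) ((+ 4) ℤ.^ e)))) ⟩
  (fromℕ 2 * (((+ 4) ℤ.^ e) / 1) + 1ℚ) * (1ℤ / 3) ∎
  where open ≡-Reasoning

-- Together with `odd-gap-suc`, these are the affine maps that reflection induces on gaps; going
-- through both adds one block.
even-gap-odd-gap : ∀ e → even-gap e ≡ 1ℚ + fromℕ 2 * odd-gap e
even-gap-odd-gap e rewrite even-gap-expand e | odd-gap-expand e =
  solve 1 (λ x → (con (fromℕ 2) :* x :+ con 1ℚ) :* con (1ℤ / 3) :=
    con 1ℚ :+ con (fromℕ 2) :* ((x :- con 1ℚ) :* con (1ℤ / 3))) refl (((+ 4) ℤ.^ e) / 1)

odd-gap-suc : ∀ e → odd-gap (suc e) ≡ fromℕ 2 * even-gap e - 1ℚ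
odd-gap-suc e rewrite even-gap-expand e | odd-gap-expand (suc e) | fromℤ-homo-* (+ 4) ((+ 4) ℤ.^ e) =
  solve 1 (λ x → (con (fromℕ 4) :* x :- con 1ℚ) :* con (1ℤ / 3) :=
    con (fromℕ 2) :* ((con (fromℕ 2) :* x :+ con 1ℚ) :* con (1ℤ / 3)) :- con 1ℚ) refl (((+ 4) ℤ.^ e) / 1)

-- Reflection partners in a power of two.

-- The power is the least one not below n + 1. The partner is smaller than n + 1, which makes it fit
-- for induction.
2^-complement : ∀ n → ∃₂ λ l k → suc n ℕ.+ k ≡ 2 ℕ.^ l × k ℕ.≤ n
2^-complement zero = 0 , 0 , refl , z≤n
2^-complement (suc n) with 2^-complement n
... | l , suc k , eq , k<n =
  l , k , trans (sym (ℕ.+-suc (suc n) k)) eq , ℕ.≤-trans (ℕ.n≤1+n k) (ℕ.m≤n⇒m≤1+n k<n)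
... | l , zero , eq , _ = suc l , n , trans (lemma n) (cong (2 ℕ.*_) eq) , ℕ.n≤1+n n
  where
  lemma : ∀ n → (2 ℕ.+ n) ℕ.+ n ≡ 2 ℕ.* (1 ℕ.+ n ℕ.+ 0)
  lemma = solve-∀

-- Here the power exceeds n + 1, so the partner is positive; a power of two is its own partner.
2^-suc-complement : ∀ n → ∃₂ λ l k → suc n ℕ.+ suc k ≡ 2 ℕ.^ l × k ℕ.≤ n
2^-suc-complement n with 2^-complement n
... | l , suc k , eq , k<n = l , k , eq , ℕ.<⇒≤ k<n
... | l , zero , eq , _ = suc l , n , trans (lemma n) (cong (2 ℕ.*_) eq) , ℕ.≤-refl
  where
  lemma : ∀ n → (1 ℕ.+ n) ℕ.+ (1 ℕ.+ n) ≡ 2 ℕ.* (1 ℕ.+ n ℕ.+ 0)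
  lemma = solve-∀

-- Reflection formulas for γ.

module _ (γ : ℕ → ℚ) (isGamma : IsGamma γ) where
  open IsGamma isGamma

  -- If n + k = 2^l, then 2k <= 2^l says k <= n; this symmetric form avoids truncated subtraction.
  γ-complement : ∀ l n k → n ℕ.+ k ≡ 2 ℕ.^ l → k ℕ.≤ n → γ n ≡ c l - fromℕ k + fromℕ 2 * γ k
  γ-complement l n k eq k≤n =
    subst (λ m → γ m ≡ c l - fromℕ k + fromℕ 2 * γ k)
      (trans (cong (ℕ._∸ k) (sym eq)) (ℕ.m+n∸n≡m n k))
      (γ-rec l k (begin
        2 ℕ.* k     ≡⟨ cong (k ℕ.+_) (ℕ.+-identityʳ k) ⟩
        k ℕ.+ k     ≤⟨ ℕ.+-monoˡ-≤ k k≤n ⟩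
        n ℕ.+ k     ≡⟨ eq ⟩
        2 ℕ.^ l     ∎))
    where open ℕ.≤-Reasoning

  -- 2^l + k is the reflection of 2^l - k in 2^(l+1).
  γ-2^+k : ∀ l k → k ℕ.≤ 2 ℕ.^ l →
    γ (2 ℕ.^ l ℕ.+ k) ≡ c (suc l) - fromℕ (2 ℕ.^ l ℕ.∸ k) + fromℕ 2 * γ (2 ℕ.^ l ℕ.∸ k)
  γ-2^+k l k k≤2^l = γ-complement (suc l) (2 ℕ.^ l ℕ.+ k) (2 ℕ.^ l ℕ.∸ k)
    (begin
      2 ℕ.^ l ℕ.+ k ℕ.+ (2 ℕ.^ l ℕ.∸ k)   ≡⟨ ℕ.+-assoc (2 ℕ.^ l) k _ ⟩
      2 ℕ.^ l ℕ.+ (k ℕ.+ (2 ℕ.^ l ℕ.∸ k)) ≡⟨ cong (2 ℕ.^ l ℕ.+_) (ℕ.m+[n∸m]≡n k≤2^l) ⟩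
      2 ℕ.^ l ℕ.+ 2 ℕ.^ l                 ≡⟨ cong (2 ℕ.^ l ℕ.+_) (ℕ.+-identityʳ (2 ℕ.^ l)) ⟨
      2 ℕ.^ suc l                       ∎)
    (ℕ.≤-trans (ℕ.m∸n≤m (2 ℕ.^ l) k) (ℕ.m≤m+n (2 ℕ.^ l) k))
    where open ≡-Reasoning

  -- Two reflections lead from 2^l + k through 2^l - k to k, each contributing a factor 2.
  γ-reflect-above : ∀ l k → 2 ℕ.* k ℕ.≤ 2 ℕ.^ l →
    γ (2 ℕ.^ l ℕ.+ k) ≡ c l - fromℕ k + fromℕ 4 * γ k
  γ-reflect-above l k 2k≤2^l =
    algebra (c l) (c (suc l)) (fromℕ k) (γ k)
      (fromℕ-complement l (2 ℕ.^ l ℕ.∸ k) k (ℕ.m∸n+n≡m k≤2^l)) (γ-rec l k 2k≤2^l) (γ-2^+k l k k≤2^l)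
    where
    k≤2^l = ℕ.≤-trans (ℕ.m≤m+n k _) 2k≤2^l
    algebra : ∀ p q k g {j h x} → j ≡ p + q - k → h ≡ p - k + fromℕ 2 * g →
      x ≡ q - j + fromℕ 2 * h → x ≡ p - k + fromℕ 4 * g
    algebra p q k g refl refl refl =
      solve 4 (λ p q k g → q :- (p :+ q :- k) :+ con (fromℕ 2) :* (p :- k :+ con (fromℕ 2) :* g)
        := p :- k :+ con (fromℕ 4) :* g) refl p q k g

  -- The lower bound on k makes k the reflection of a smaller or equal j = 2^(l-1) - k. Expanding
  -- γ(2^l - k) by k and γ(k) by j leaves only γ(j) to compare.
  γ-reflect-middle : ∀ l k → 2 ℕ.^ l ℕ.≤ 4 ℕ.* k → 2 ℕ.* k ℕ.≤ 2 ℕ.^ l →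
    γ (2 ℕ.^ l ℕ.∸ k) ≡ γ k + fromℕ 2 * γ (2 ℕ.^ (l ℕ.∸ 1) ℕ.∸ k)
  -- At l = 0 no k qualifies: 1 <= 4k makes k positive, and then 2k <= 1 fails.
  γ-reflect-middle zero (suc k) _ (s≤s le) = contradiction (subst (ℕ._≤ 0) (ℕ.+-suc k _) le) λ ()
  γ-reflect-middle (suc l) k 2^l≤4k 2k≤2^l =
    algebra (c l) (c (suc l)) (fromℕ j) (γ j)
      (fromℕ-complement l k j k+j≡2^l) (γ-complement l k j k+j≡2^l j≤k) (γ-rec (suc l) k 2k≤2^l)
    where
    j = 2 ℕ.^ l ℕ.∸ k
    k+j≡2^l = ℕ.m+[n∸m]≡n {k} {2 ℕ.^ l} (ℕ.*-cancelˡ-≤ 2 2k≤2^l)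
    4k≡2[k+k] : ∀ k → 4 ℕ.* k ≡ 2 ℕ.* (k ℕ.+ k)
    4k≡2[k+k] = solve-∀
    j≤k : j ℕ.≤ k
    j≤k = ℕ.m≤n+o⇒m∸n≤o (2 ℕ.^ l) k
      (ℕ.*-cancelˡ-≤ 2 (subst (2 ℕ.^ suc l ℕ.≤_) (4k≡2[k+k] k) 2^l≤4k))
    algebra : ∀ p q j h {k g x} → k ≡ p + q - j → g ≡ p - j + fromℕ 2 * h →
      x ≡ q - k + fromℕ 2 * g → x ≡ g + fromℕ 2 * h
    algebra p q j h refl refl refl =
      solve 4 (λ p q j h → q :- (p :+ q :- j) :+ con (fromℕ 2) :* (p :- j :+ con (fromℕ 2) :* h)
        := p :- j :+ con (fromℕ 2) :* h :+ con (fromℕ 2) :* h) refl p q j h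

  -- Both arguments on the upper side reflect in 2^(l+1), to 2^l - k and 2^l + 1 - k. Subtracting
  -- the two instances leaves the 1 by which these partners differ.
  γ-step : ∀ l k → 1 ℕ.≤ k → k ℕ.≤ 2 ℕ.^ l →
    γ (2 ℕ.^ l ℕ.+ k) ≡
      fromℕ 1 + γ (2 ℕ.^ l ℕ.+ k ℕ.∸ 1) + fromℕ 2 * γ (2 ℕ.^ l ℕ.∸ k)
        - fromℕ 2 * γ (2 ℕ.^ l ℕ.+ 1 ℕ.∸ k)
  γ-step l (suc k) _ k<2^l
    rewrite ℕ.+-suc (2 ℕ.^ l) k | ℕ.+-comm (2 ℕ.^ l) 1 | ℕ.+-∸-assoc 1 k<2^l =
    algebra (c (suc l)) (fromℕ j) (γ j) (γ (suc j)) (fromℕ-suc j)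
      (trans (cong γ (sym (ℕ.+-suc (2 ℕ.^ l) k))) (γ-2^+k l (suc k) k<2^l))
      (subst (λ j → γ (2 ℕ.^ l ℕ.+ k) ≡ c (suc l) - fromℕ j + fromℕ 2 * γ j)
        (ℕ.+-∸-assoc 1 k<2^l) (γ-2^+k l k (ℕ.<⇒≤ k<2^l)))
    where
    j = 2 ℕ.^ l ℕ.∸ suc k
    algebra : ∀ q j g h {i x y} → i ≡ 1ℚ + j → x ≡ q - j + fromℕ 2 * g → y ≡ q - i + fromℕ 2 * h →
      x ≡ fromℕ 1 + y + fromℕ 2 * g - fromℕ 2 * h
    algebra q j g h refl refl refl =
      solve 4 (λ q j g h → q :- j :+ con (fromℕ 2) :* g :=
        con (fromℕ 1) :+ (q :- (con 1ℚ :+ j) :+ con (fromℕ 2) :* h) :+ con (fromℕ 2) :* g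
          :- con (fromℕ 2) :* h) refl q j g h

  -- Even and odd arguments.

  γ-2n-complement : ∀ l n k → n ℕ.+ k ≡ 2 ℕ.^ l → k ℕ.≤ n →
    γ (2 ℕ.* n) ≡ c (suc l) - fromℕ 2 * fromℕ k + fromℕ 2 * γ (2 ℕ.* k)
  γ-2n-complement l n k eq k≤n = subst
    (λ j → γ (2 ℕ.* n) ≡ c (suc l) - j + fromℕ 2 * γ (2 ℕ.* k)) (fromℕ-2* k)
    (γ-complement (suc l) (2 ℕ.* n) (2 ℕ.* k)
      (trans (sym (ℕ.*-distribˡ-+ 2 n k)) (cong (2 ℕ.*_) eq)) (ℕ.*-monoʳ-≤ 2 k≤n))

  γ-2n+1-complement : ∀ l n k → suc n ℕ.+ k ≡ 2 ℕ.^ l → k ℕ.≤ n →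
    γ (suc (2 ℕ.* n)) ≡ c (suc l) - (1ℚ + fromℕ 2 * fromℕ k) + fromℕ 2 * γ (suc (2 ℕ.* k))
  γ-2n+1-complement l n k eq k≤n = subst
    (λ j → γ (suc (2 ℕ.* n)) ≡ c (suc l) - j + fromℕ 2 * γ (suc (2 ℕ.* k)))
    (trans (fromℕ-suc (2 ℕ.* k)) (cong (λ j → 1ℚ + j) (fromℕ-2* k)))
    (γ-complement (suc l) (suc (2 ℕ.* n)) (suc (2 ℕ.* k))
      (trans (lemma n k) (cong (2 ℕ.*_) eq)) (s≤s (ℕ.*-monoʳ-≤ 2 k≤n)))
    where
    lemma : ∀ n k → (1 ℕ.+ 2 ℕ.* n) ℕ.+ (1 ℕ.+ 2 ℕ.* k) ≡ 2 ℕ.* (1 ℕ.+ n ℕ.+ k)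
    lemma = solve-∀

  γ-2n : ∀ n → γ (2 ℕ.* n) ≡ fromℕ n - γ n
  γ-2n = <-rec _ step
    where
    algebra : ∀ p q k h {n g x y} → n ≡ p + q - k → g ≡ p - k + fromℕ 2 * h →
      x ≡ q - fromℕ 2 * k + fromℕ 2 * y → y ≡ k - h → x ≡ n - g
    algebra p q k h refl refl refl refl =
      solve 4 (λ p q k h →
        q :- con (fromℕ 2) :* k :+ con (fromℕ 2) :* (k :- h) :=
        p :+ q :- k :- (p :- k :+ con (fromℕ 2) :* h)) refl p q k h

    at-zero : ∀ {x} → x ≡ 0ℚ → x ≡ fromℕ 0 - x
    at-zero refl = refl

    step : ∀ n → (∀ {m} → m ℕ.< n → γ (2 ℕ.* m) ≡ fromℕ m - γ m) → γ (2 ℕ.* n) ≡ fromℕ n - γ n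
    step zero ih = at-zero γ-zero
    -- Reflecting n + 1 in 2^l and its double in 2^(l+1) gives partners k and 2k, to which induction
    -- applies.
    step (suc n) ih with l , k , eq , k≤n ← 2^-complement n =
      algebra (c l) (c (suc l)) (fromℕ k) (γ k) (fromℕ-complement l (suc n) k eq)
        (γ-complement l (suc n) k eq k≤1+n) (γ-2n-complement l (suc n) k eq k≤1+n) (ih (s≤s k≤n))
      where k≤1+n = ℕ.m≤n⇒m≤1+n k≤n

  -- Reflection swaps upper and lower neighbours, so the two gaps are proved by one joint induction.
  γ-2n+1 : ∀ n → γ (suc (2 ℕ.* n)) ≡ γ (2 ℕ.* n) + even-gap (b n)
               × γ (suc (2 ℕ.* n)) ≡ γ (2 ℕ.* suc n) + odd-gap (b (suc (2 ℕ.* n)))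
  γ-2n+1 = <-rec _ step
    where
    FromBelow FromAbove : ℕ → Set
    FromBelow n = γ (suc (2 ℕ.* n)) ≡ γ (2 ℕ.* n) + even-gap (b n)
    FromAbove n = γ (suc (2 ℕ.* n)) ≡ γ (2 ℕ.* suc n) + odd-gap (b (suc (2 ℕ.* n)))

    from-above : ∀ n → (∀ {k} → k ℕ.≤ n → FromBelow k) → FromAbove n
    -- In 2^(l+1), the numbers 2n + 1 and 2n + 2 reflect to 2k + 1 and 2k, so the even neighbour
    -- moves from above to below.
    from-above n ih with l , k , eq , k≤n ← 2^-complement n =
      algebra (c (suc l)) (fromℕ k) (γ (2 ℕ.* k)) (even-gap (b k))
        (γ-2n+1-complement l n k eq k≤n)
        (γ-2n-complement l (suc n) k eq (ℕ.m≤n⇒m≤1+n k≤n))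
        (ih k≤n)
        (trans (cong odd-gap (proj₁ (b-complement l k n (trans (cong suc (ℕ.+-comm k n)) eq)) k≤n))
          (odd-gap-suc (b k)))
      where
      algebra : ∀ q k w d {x y z e} → x ≡ q - (1ℚ + fromℕ 2 * k) + fromℕ 2 * z →
        y ≡ q - fromℕ 2 * k + fromℕ 2 * w → z ≡ w + d → e ≡ fromℕ 2 * d - 1ℚ → x ≡ y + e
      algebra q k w d refl refl refl refl =
        solve 4 (λ q k w d → q :- (con 1ℚ :+ con (fromℕ 2) :* k) :+ con (fromℕ 2) :* (w :+ d)
          := q :- con (fromℕ 2) :* k :+ con (fromℕ 2) :* w :+ (con (fromℕ 2) :* d :- con 1ℚ))
          refl q k w d

    from-below : ∀ n → (∀ {k} → k ℕ.< n → FromAbove k) → FromBelow n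
    -- The value γ(1) = `c 0` = 1 starts the induction.
    from-below zero ih = at-zero γ-zero (γ-complement 0 1 0 refl z≤n)
      where
      at-zero : ∀ {x y} → x ≡ 0ℚ → y ≡ c 0 - fromℕ 0 + fromℕ 2 * x → y ≡ x + even-gap 0
      at-zero refl refl = refl
    -- 2n + 2 reflects to 2k + 2 and 2n + 3 to 2k + 1; a positive partner is needed for the odd
    -- number below it to exist.
    from-below (suc n) ih with l , k , eq , k≤n ← 2^-suc-complement n =
      algebra (c (suc l)) (fromℕ k) (γ (2 ℕ.* suc k)) (odd-gap (b (suc (2 ℕ.* k))))
        (γ-2n+1-complement l (suc n) k eq′ (ℕ.m≤n⇒m≤1+n k≤n))
        (γ-2n-complement l (suc n) (suc k) eq (s≤s k≤n)) (fromℕ-suc k) (ih (s≤s k≤n))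
        (trans (even-gap-odd-gap (b (suc n)))
          (cong (λ e → 1ℚ + fromℕ 2 * odd-gap e)
            (sym (proj₂ (b-complement l (suc n) k eq′) (s≤s k≤n)))))
      where
      eq′ = trans (sym (ℕ.+-suc (suc n) k)) eq
      algebra : ∀ q k w d {j x y z e} → x ≡ q - (1ℚ + fromℕ 2 * k) + fromℕ 2 * z →
        y ≡ q - fromℕ 2 * j + fromℕ 2 * w → j ≡ 1ℚ + k → z ≡ w + d → e ≡ 1ℚ + fromℕ 2 * d → x ≡ y + e
      algebra q k w d refl refl refl refl refl =
        solve 4 (λ q k w d → q :- (con 1ℚ :+ con (fromℕ 2) :* k) :+ con (fromℕ 2) :* (w :+ d)
          := q :- con (fromℕ 2) :* (con 1ℚ :+ k) :+ con (fromℕ 2) :* w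
             :+ (con 1ℚ :+ con (fromℕ 2) :* d))
          refl q k w d

    step : ∀ n → (∀ {m} → m ℕ.< n → FromBelow m × FromAbove m) → FromBelow n × FromAbove n
    -- The gap from below comes first, since the one from above may call on it at n itself, as
    -- happens at n = 0.
    step n ih = below ℕ.≤-refl , from-above n below
      where
      below : ∀ {k} → k ℕ.≤ n → FromBelow k
      below {k} k≤n = from-below k λ j<k → proj₂ (ih (ℕ.<-≤-trans j<k k≤n))

  γ-above-even : ∀ n {m} → m ≡ suc (2 ℕ.* n) →
    γ m ≡ γ (2 ℕ.* n) + even-gap (b n) × γ m ≡ fromℕ n - γ n + even-gap (b n)
  γ-above-even n refl = gap , trans gap (cong (_+ even-gap (b n)) (γ-2n n))
    where gap = proj₁ (γ-2n+1 n)

  γ-below-even : ∀ n {m} → m ≡ suc (2 ℕ.* n) →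
    γ m ≡ γ (2 ℕ.* suc n) + odd-gap (b m) × γ m ≡ fromℕ (suc n) - γ (suc n) + odd-gap (b m)
  γ-below-even n refl = gap , trans gap (cong (_+ odd-gap (b (suc (2 ℕ.* n)))) (γ-2n (suc n)))
    where gap = proj₂ (γ-2n+1 n)

theorem1p5 : (γ : ℕ → ℚ) → IsGamma γ →
    (∀ l k → 2 ℕ.* k ℕ.≤ 2 ℕ.^ l →
    γ (2 ℕ.^ l ℕ.+ k) ≡ c l - fromℕ k + fromℕ 4 * γ k)
    ×
    (∀ l k → 2 ℕ.^ l ℕ.≤ 4 ℕ.* k → 2 ℕ.* k ℕ.≤ 2 ℕ.^ l →
    γ (2 ℕ.^ l ℕ.∸ k) ≡ γ k + fromℕ 2 * γ (2 ℕ.^ (l ℕ.∸ 1) ℕ.∸ k))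
    ×
    (∀ l k → 1 ℕ.≤ k → k ℕ.≤ 2 ℕ.^ l →
    γ (2 ℕ.^ l ℕ.+ k) ≡
    fromℕ 1 + γ (2 ℕ.^ l ℕ.+ k ℕ.∸ 1) + fromℕ 2 * γ (2 ℕ.^ l ℕ.∸ k)
    - fromℕ 2 * γ (2 ℕ.^ l ℕ.+ 1 ℕ.∸ k))
    ×
    (∀ n →
    γ (2 ℕ.* n) ≡ fromℕ n - γ n
    × γ (2 ℕ.* n ℕ.+ 1) ≡
    γ (2 ℕ.* n) + ((+ 2) ℤ.^ (1 ℕ.+ 2 ℕ.* b n) ℤ.+ 1ℤ) / 3
    × γ (2 ℕ.* n ℕ.+ 1) ≡
    fromℕ n - γ n + ((+ 2) ℤ.^ (1 ℕ.+ 2 ℕ.* b n) ℤ.+ 1ℤ) / 3)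
    ×
    (∀ n → 1 ℕ.≤ n →
    γ (2 ℕ.* n ℕ.∸ 1) ≡
    γ (2 ℕ.* n) + ((+ 4) ℤ.^ b (2 ℕ.* n ℕ.∸ 1) ℤ.- 1ℤ) / 3
    × γ (2 ℕ.* n ℕ.∸ 1) ≡
    fromℕ n - γ n + ((+ 4) ℤ.^ b (2 ℕ.* n ℕ.∸ 1) ℤ.- 1ℤ) / 3)
theorem1p5 γ isGamma =
  γ-reflect-above γ isGamma , γ-reflect-middle γ isGamma , γ-step γ isGamma ,
  (λ n → γ-2n γ isGamma n , γ-above-even γ isGamma n (ℕ.+-comm (2 ℕ.* n) 1)) ,
  (λ { (suc n) _ → γ-below-even γ isGamma n (ℕ.+-suc n (n ℕ.+ 0)) })
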